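{- For integers $l,k\ge 2$, as $n\to\infty$, $$ex(n,P_l,C_{2k})\le (1+o(1))\frac12 (k-1)^{\frac{l-1}{2}}n^{\frac{l+1}{2}}.$$
   Context: $C_k$ denotes the cycle with $k$ vertices and $P_l$ the path with $l$ vertices. $ex(n,H,F)$ is the maximum number of subgraphs isomorphic to $H$ in an $n$-vertex graph containing no subgraph isomorphic to $F$. -}

module Defs where

open import Data.Bool using (true; false)
open import Data.Empty using (⊥)
open import Data.Fin using (Fin; zero; suc; toℕ)
open import Data.Fin.Properties using (all?; any?; nonZeroIndex) renaming (_≟_ to _≟ᶠ_)
open import Data.Fin.Subset using (Subset; _∈_)
open import Data.Fin.Subset.Properties using (_∈?_; ⊆-antisym)
open import Data.Integer using (+_)
open import Data.List using (List; []; _∷_; length; map; filter; allFin; cartesianProduct; cartesianProductWith)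
open import Data.List.Extrema.Nat using (max)
open import Data.List.Membership.Propositional using (lose) renaming (_∈_ to _∈ˡ_)
open import Data.List.Membership.Propositional.Properties using (∈-cartesianProductWith⁺; ∈-allFin)
open import Data.List.Relation.Unary.All using ([]; _∷_)
open import Data.List.Relation.Unary.AllPairs using ([]; _∷_)
open import Data.List.Relation.Unary.Any using (here; there; satisfied) renaming (any? to anyˡ?)
open import Data.List.Relation.Unary.Unique.Propositional using (Unique)
open import Data.List.Relation.Unary.Unique.Propositional.Properties using (cartesianProductWith⁺; cartesianProduct⁺; filter⁺)
open import Data.Nat using (ℕ; zero; suc; _%_; _≟_)
open import Data.Product using (∃; _×_; _,_)
open import Data.Rational using (ℚ; _/_; _*_; _≤_)
open import Data.Vec using (Vec; []; _∷_; lookup; tabulate)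
open import Data.Vec.Properties using (∷-injective)
open import Function.Bundles using (_⇔_; mk⇔; Equivalence)
open import Level using (0ℓ)
open import Relation.Binary.Core using (Rel)
open import Relation.Binary.Definitions using (Decidable; Symmetric)
open import Relation.Binary.PropositionalEquality using (_≡_; refl; cong₂)
open import Relation.Nullary using (Dec; ¬_; does; no)
open import Relation.Nullary.Decidable using (map′; _×-dec_; _⊎-dec_; _→-dec_)

private
  variable
    h n : ℕ

infixr 5 _∷_

-- A simple graph on the vertex set Fin n.  In S ∷ G the set S holds the
-- neighbours of vertex 0 among the later vertices, and G is the graph on those
-- later vertices, re-indexed by Fin n.  So each edge set has exactly one
-- representation (Adj-ext below).

data Graph : ℕ → Set where
  []  : Graph 0
  _∷_ : Subset n → Graph n → Graph (suc n)

Adj : Graph n → Rel (Fin n) 0ℓ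
Adj (S ∷ G) zero    zero    = ⊥
Adj (S ∷ G) zero    (suc j) = j ∈ S
Adj (S ∷ G) (suc i) zero    = i ∈ S
Adj (S ∷ G) (suc i) (suc j) = Adj G i j

adj? : (G : Graph n) → Decidable (Adj G)
adj? (S ∷ G) zero    zero    = no λ ()
adj? (S ∷ G) zero    (suc j) = j ∈? S
adj? (S ∷ G) (suc i) zero    = i ∈? S
adj? (S ∷ G) (suc i) (suc j) = adj? G i j

Adj-irrefl : (G : Graph n) → ∀ i → ¬ Adj G i i
Adj-irrefl (S ∷ G) zero    ()
Adj-irrefl (S ∷ G) (suc i) = Adj-irrefl G i

Adj-sym : (G : Graph n) → Symmetric (Adj G)
Adj-sym (S ∷ G) {zero}  {suc j} p = p
Adj-sym (S ∷ G) {suc i} {zero}  p = p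
Adj-sym (S ∷ G) {suc i} {suc j} p = Adj-sym G p

Adj-ext : (G H : Graph n) → (∀ i j → Adj G i j ⇔ Adj H i j) → G ≡ H
Adj-ext []      []      _ = refl
Adj-ext (S ∷ G) (T ∷ H) e = cong₂ _∷_
  (⊆-antisym (λ {j} → Equivalence.to (e zero (suc j)))
             (λ {j} → Equivalence.from (e zero (suc j))))
  (Adj-ext G H λ i j → e (suc i) (suc j))

-- Distinct vertices i, j are joined when R i j or R j i; loops are dropped.

fromRel : {R : Rel (Fin n) 0ℓ} → Decidable R → Graph n
fromRel {zero}  R? = []
fromRel {suc n} R? =
  tabulate (λ j → does (R? zero (suc j) ⊎-dec R? (suc j) zero)) ∷
  fromRel (λ i j → R? (suc i) (suc j))

path : ∀ l → Graph l
path l = fromRel λ i j → suc (toℕ i) ≟ toℕ j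

-- The k-vertex cycle when k ≥ 3.

cycle : ∀ k → Graph k
cycle k = fromRel λ i j → let instance _ = nonZeroIndex i in
  suc (toℕ i) % k ≟ toℕ j

allVecs : ∀ {A : Set} → List A → ∀ n → List (Vec A n)
allVecs xs zero    = [] ∷ []
allVecs xs (suc n) = cartesianProductWith _∷_ xs (allVecs xs n)

∈-allVecs : ∀ {A : Set} {xs : List A} → (∀ x → x ∈ˡ xs) →
            (v : Vec A n) → v ∈ˡ allVecs xs n
∈-allVecs all []      = here refl
∈-allVecs all (x ∷ v) = ∈-cartesianProductWith⁺ _∷_ (all x) (∈-allVecs all v)

allVecs-unique : ∀ {A : Set} {xs : List A} → Unique xs → ∀ n → Unique (allVecs xs n)
allVecs-unique u zero    = [] ∷ []
allVecs-unique u (suc n) = cartesianProductWith⁺ _∷_ ∷-injective u (allVecs-unique u n)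

allSubsets : ∀ n → List (Subset n)
allSubsets = allVecs (true ∷ false ∷ [])

∈-allSubsets : (S : Subset n) → S ∈ˡ allSubsets n
∈-allSubsets = ∈-allVecs λ where
  true  → here refl
  false → there (here refl)

allSubsets-unique : ∀ n → Unique (allSubsets n)
allSubsets-unique = allVecs-unique (((λ ()) ∷ []) ∷ [] ∷ [])

allGraphs : ∀ n → List (Graph n)
allGraphs zero    = [] ∷ []
allGraphs (suc n) = cartesianProductWith _∷_ (allSubsets n) (allGraphs n)

∈-allGraphs : (G : Graph n) → G ∈ˡ allGraphs n
∈-allGraphs []      = here refl
∈-allGraphs (S ∷ G) = ∈-cartesianProductWith⁺ _∷_ (∈-allSubsets S) (∈-allGraphs G)

allGraphs-unique : ∀ n → Unique (allGraphs n)
allGraphs-unique zero    = [] ∷ []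
allGraphs-unique (suc n) =
  cartesianProductWith⁺ _∷_ (λ { refl → refl , refl }) (allSubsets-unique n) (allGraphs-unique n)

-- A candidate subgraph: a vertex set together with an edge set.

VE : ℕ → Set
VE n = Subset n × Graph n

infix 4 _⊑_ _⊑?_ _≅_ _≅?_

_⊑_ : VE n → Graph n → Set
(V , E) ⊑ G = ∀ i j → Adj E i j → Adj G i j × i ∈ V × j ∈ V

-- The isomorphism is an injective map φ, given by its table of values.

IsIso : Graph h → VE n → Vec (Fin n) h → Set
IsIso H (V , E) φ =
    (∀ i j → lookup φ i ≡ lookup φ j → i ≡ j)
  × (∀ v → v ∈ V ⇔ ∃ λ i → lookup φ i ≡ v)
  × (∀ i j → Adj H i j ⇔ Adj E (lookup φ i) (lookup φ j))

_≅_ : Graph h → VE n → Set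
H ≅ S = ∃ (IsIso H S)

_⇔-dec_ : {A B : Set} → Dec A → Dec B → Dec (A ⇔ B)
a? ⇔-dec b? = map′ (λ (f , g) → mk⇔ f g)
                   (λ e → Equivalence.to e , Equivalence.from e)
                   ((a? →-dec b?) ×-dec (b? →-dec a?))

_⊑?_ : (S : VE n) (G : Graph n) → Dec (S ⊑ G)
(V , E) ⊑? G = all? λ i → all? λ j →
  adj? E i j →-dec (adj? G i j ×-dec (i ∈? V) ×-dec (j ∈? V))

isIso? : (H : Graph h) (S : VE n) (φ : Vec (Fin n) h) → Dec (IsIso H S φ)
isIso? H (V , E) φ =
        (all? λ i → all? λ j → (lookup φ i ≟ᶠ lookup φ j) →-dec (i ≟ᶠ j))
  ×-dec (all? λ v → (v ∈? V) ⇔-dec any? λ i → lookup φ i ≟ᶠ v)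
  ×-dec (all? λ i → all? λ j → adj? H i j ⇔-dec adj? E (lookup φ i) (lookup φ j))

_≅?_ : (H : Graph h) (S : VE n) → Dec (H ≅ S)
_≅?_ {h} {n} H S = map′ satisfied
  (λ (φ , iso) → lose (∈-allVecs ∈-allFin φ) iso)
  (anyˡ? (isIso? H S) (allVecs (allFin n) h))

copies : Graph h → Graph n → List (VE n)
copies {n = n} H G =
  filter (λ S → (S ⊑? G) ×-dec (H ≅? S)) (cartesianProduct (allSubsets n) (allGraphs n))

copies-unique : (H : Graph h) (G : Graph n) → Unique (copies H G)
copies-unique {n = n} H G =
  filter⁺ (λ S → (S ⊑? G) ×-dec (H ≅? S))
          (cartesianProduct⁺ (allSubsets-unique n) (allGraphs-unique n))

count : Graph h → Graph n → ℕ
count H G = length (copies H G)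

-- The 0 in max only supplies the value 0 when no n-vertex graph is F-free.

ex : ∀ {f} (n : ℕ) → Graph h → Graph f → ℕ
ex n H F = max 0 (map (count H) (filter (λ G → count F G ≟ 0) (allGraphs n)))

-- For c ≥ 0 this says a ≤ c √m, with both (non-negative) sides squared so that
-- the irrational square root is not needed.

infix 4 _≤_·√_

_≤_·√_ : ℕ → ℚ → ℕ → Set
a ≤ c ·√ m = (+ a / 1) * (+ a / 1) ≤ c * c * (+ m / 1)

{-# OPTIONS --safe #-}
module Submission where

-- Let q = (k − 1) n.  In a graph without C_2k the degrees of the neighbours of
-- any vertex v sum to at most q + C deg v, with C depending only on k: otherwise
-- either the edges between N(v) and its complement or those inside N(v) are so
-- many that repeated deletion of vertices of small degree leaves a non-empty
-- core, in which a path with 2k − 1 vertices and both ends in N(v) can be built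
-- greedily; together with v it is a C_2k.  For the numbers W_j of walks of
-- length j this gives W_(j+2) ≤ q W_j + C W_(j+1), hence W_j ≤ n m^j for every
-- m with q + C m ≤ m²; the start W_1 ≤ n m follows from 2 m d ≤ m² + d² and
-- W_2 = Σ d².  One can take m = ⌊√q⌋ + O(1).  Finally each path with l vertices
-- is traversed by two walks of length l − 1.

open import Defs
open import Data.Empty using (⊥-elim)
open import Data.Fin using (Fin; zero; suc; toℕ; opposite)
import Data.Fin.Properties as Fin
open import Data.Fin.Subset using () renaming (_∈_ to _∈ₛ_)
open import Data.Fin.Subset.Properties using (⊆-antisym)
open import Data.Integer as ℤ using (+≤+)
import Data.Integer.Properties as ℤ
open import Data.List
  using (List; []; _∷_; length; map; filter; _++_; lookup; allFin; concatMap; cartesianProduct)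
open import Data.List.Extrema.Nat using (argmax-all)
import Data.List.Membership.DecPropositional as DecMembership
open import Data.List.Membership.Propositional using (_∈_; _∉_; lose; find)
open import Data.List.Membership.Propositional.Properties
  using (∈-filter⁺; ∈-filter⁻; ∈-cartesianProduct⁺; ∈-length; ∈-++⁺ˡ; ∈-++⁺ʳ; ∈-++⁻;
         ∈-allFin; ∈-lookup; ∈-map⁺; ∈-concatMap⁺)
open import Data.List.Properties using (length-++; length-filter; length-tabulate; length-map)
open import Data.List.Relation.Binary.Subset.Propositional using (_⊆_)
open import Data.List.Relation.Unary.All as All using (All; []; _∷_)
open import Data.List.Relation.Unary.All.Properties using (─⁺; ¬Any⇒All¬; map⁺; all-filter)
open import Data.List.Relation.Unary.AllPairs using ([]; _∷_)
open import Data.List.Relation.Unary.Any as Any using (Any; here; there; any?; _─_)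
open import Data.List.Relation.Unary.Any.Properties using (lookup-result)
open import Data.List.Relation.Unary.Linked using (Linked; [-]; _∷_)
open import Data.List.Relation.Unary.Unique.Propositional using (Unique)
import Data.List.Relation.Unary.Unique.Propositional.Properties as Unique
open import Data.Nat renaming (_≟_ to _≟ℕ_)
open import Data.Nat.Coprimality using (Coprime)
open import Data.Nat.DivMod using (m<n⇒m%n≡m; n%n≡0)
open import Data.Nat.ListAction using (sum)
open import Data.Nat.Properties hiding (_≟_)
open import Data.Nat.Tactic.RingSolver using (solve-∀)
open import Data.Product using (∃; ∃₂; ∃-syntax; _×_; _,_; proj₁; proj₂)
open import Data.Rational as ℚ using (ℚ; 0ℚ; 1ℚ; ½; mkℚ; toℚᵘ)
import Data.Rational.Properties as ℚ
open import Data.Rational.Unnormalised as ℚᵘ using (mkℚᵘ; *≤*)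
import Data.Rational.Unnormalised.Properties as ℚᵘ
open import Data.Sum using (_⊎_; inj₁; inj₂; [_,_]′; swap)
open import Data.Vec as Vec using (Vec; tabulate; []; _∷_)
open import Data.Vec.Properties using (lookup⇒[]=; []=⇒lookup; lookup∘tabulate)
open import Function using (_∘_; flip; id)
open import Function.Bundles using (_⇔_; mk⇔; Equivalence)
open import Level using (0ℓ)
open import Relation.Binary.Core using (Rel)
open import Relation.Binary.Definitions using () renaming (Decidable to Decidable₂)
open import Relation.Binary.PropositionalEquality
open import Relation.Nullary using (Dec; yes; no; ¬_; does)
open import Relation.Nullary.Decidable using (¬?; _×-dec_; _⊎-dec_; dec-true; decidable-stable)
open import Relation.Unary using (Pred; Decidable)

private
  variable
    A B : Set
    h l n : ℕ

-- Sums, removals and counts over lists.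

∑ : List A → (A → ℕ) → ℕ
∑ xs f = sum (map f xs)

∑-mono : ∀ xs {f g : A → ℕ} → (∀ x → f x ≤ g x) → ∑ xs f ≤ ∑ xs g
∑-mono []       f≤g = z≤n
∑-mono (x ∷ xs) f≤g = +-mono-≤ (f≤g x) (∑-mono xs f≤g)

∑-cong : ∀ xs {f g : A → ℕ} → (∀ x → f x ≡ g x) → ∑ xs f ≡ ∑ xs g
∑-cong []       f≡g = refl
∑-cong (x ∷ xs) f≡g = cong₂ _+_ (f≡g x) (∑-cong xs f≡g)

∑-0 : ∀ (xs : List A) → ∑ xs (λ _ → 0) ≡ 0
∑-0 []       = refl
∑-0 (x ∷ xs) = ∑-0 xs

∑-const : ∀ (xs : List A) c → ∑ xs (λ _ → c) ≡ length xs * c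
∑-const []       c = refl
∑-const (x ∷ xs) c = cong (c +_) (∑-const xs c)

∑-+ : ∀ xs {f g : A → ℕ} → ∑ xs (λ x → f x + g x) ≡ ∑ xs f + ∑ xs g
∑-+ []               = refl
∑-+ (x ∷ xs) {f} {g} = begin
  f x + g x + ∑ xs (λ x → f x + g x)  ≡⟨ cong (f x + g x +_) (∑-+ xs) ⟩
  f x + g x + (∑ xs f + ∑ xs g)       ≡⟨ rearrange (f x) (g x) _ _ ⟩
  f x + ∑ xs f + (g x + ∑ xs g)       ∎
  where
  open ≡-Reasoning
  rearrange : ∀ a b c d → a + b + (c + d) ≡ a + c + (b + d)
  rearrange = solve-∀

∑-* : ∀ c xs {f : A → ℕ} → ∑ xs (λ x → c * f x) ≡ c * ∑ xs f
∑-* c []           = sym (*-zeroʳ c)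
∑-* c (x ∷ xs) {f} = trans (cong (c * f x +_) (∑-* c xs)) (sym (*-distribˡ-+ c (f x) _))

∑-swap : ∀ {B : Set} (xs : List A) (ys : List B) {f : A → B → ℕ} →
         ∑ xs (λ x → ∑ ys (f x)) ≡ ∑ ys (λ y → ∑ xs (λ x → f x y))
∑-swap []       ys     = sym (∑-0 ys)
∑-swap (x ∷ xs) ys {f} = trans (cong (∑ ys (f x) +_) (∑-swap xs ys)) (sym (∑-+ ys))

∑-remove : ∀ {P : Pred A 0ℓ} {xs} (f : A → ℕ) (p : Any P xs) →
           ∑ xs f ≡ f (Any.lookup p) + ∑ (xs ─ p) f
∑-remove f (here _)              = refl
∑-remove f (there {x = x} {xs} p) = begin
  f x + ∑ xs f                                  ≡⟨ cong (f x +_) (∑-remove f p) ⟩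
  f x + (f (Any.lookup p) + ∑ (xs ─ p) f)       ≡⟨ rearrange (f x) (f (Any.lookup p)) _ ⟩
  f (Any.lookup p) + (f x + ∑ (xs ─ p) f)       ∎
  where
  open ≡-Reasoning
  rearrange : ∀ a b c → a + (b + c) ≡ b + (a + c)
  rearrange = solve-∀

Unique-remove : ∀ {P : Pred A 0ℓ} {xs} (p : Any P xs) → Unique xs → Unique (xs ─ p)
Unique-remove (here _)  (_ ∷ u)  = u
Unique-remove (there p) (x∉ ∷ u) = ─⁺ p x∉ ∷ Unique-remove p u

remove⊆ : ∀ {P : Pred A 0ℓ} {xs} (p : Any P xs) → (xs ─ p) ⊆ xs
remove⊆ (here _)  q         = there q
remove⊆ (there p) (here e)  = here e
remove⊆ (there p) (there q) = there (remove⊆ p q)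

remove-keeps : ∀ {x y : A} {xs} (p : x ∈ xs) → y ∈ xs → ¬ y ≡ x → y ∈ (xs ─ p)
remove-keeps (here refl) (here refl) y≢x = ⊥-elim (y≢x refl)
remove-keeps (here _)    (there q)   _   = q
remove-keeps (there p)   (here e)    _   = here e
remove-keeps (there p)   (there q)   y≢x = there (remove-keeps p q y≢x)

length-remove : ∀ {P : Pred A 0ℓ} {xs} (p : Any P xs) → length xs ≡ suc (length (xs ─ p))
length-remove (here _)  = refl
length-remove (there p) = cong suc (length-remove p)

Unique-⊆⇒≤ : ∀ {xs ys : List A} → Unique xs → xs ⊆ ys → length xs ≤ length ys
Unique-⊆⇒≤ {xs = []}     _        _   = z≤n
Unique-⊆⇒≤ {xs = x ∷ xs} (x∉ ∷ u) sub = subst (suc (length xs) ≤_) (sym (length-remove x∈ys))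
  (s≤s (Unique-⊆⇒≤ u λ y∈xs →
    remove-keeps x∈ys (sub (there y∈xs)) λ y≡x → All.lookup x∉ y∈xs (sym y≡x)))
  where x∈ys = sub (here refl)

# : {P : Pred A 0ℓ} → Decidable P → List A → ℕ
# P? xs = length (filter P? xs)

⟦_⟧ : {P : Set} → Dec P → ℕ
⟦ yes _ ⟧ = 1
⟦ no _ ⟧  = 0

#-∑ : {P : Pred A 0ℓ} (P? : Decidable P) → ∀ xs → # P? xs ≡ ∑ xs (⟦_⟧ ∘ P?)
#-∑ P? []       = refl
#-∑ P? (x ∷ xs) with P? x
... | yes _ = cong suc (#-∑ P? xs)
... | no  _ = #-∑ P? xs

#-split : {P Q : Pred A 0ℓ} (P? : Decidable P) (Q? : Decidable Q) → ∀ xs →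
          # P? xs ≡ # P? (filter Q? xs) + # P? (filter (¬? ∘ Q?) xs)
#-split P? Q? [] = refl
#-split P? Q? (x ∷ xs) with Q? x
#-split P? Q? (x ∷ xs) | yes _ with P? x
... | yes _ = cong suc (#-split P? Q? xs)
... | no  _ = #-split P? Q? xs
#-split P? Q? (x ∷ xs) | no _ with P? x
... | yes _ = trans (cong suc (#-split P? Q? xs)) (sym (+-suc (# P? (filter Q? xs)) _))
... | no  _ = #-split P? Q? xs

-- Dense relations between two lists and their cores.

pairs : {R : Rel A 0ℓ} → Decidable₂ R → List A → List A → ℕ
pairs R? xs ys = ∑ xs λ x → # (R? x) ys

-- The strict bounds leave a partner in the other list even after any `p` (from `X′`) or `q` (from
-- `Y′`) entries have been ruled out, which is what a greedy construction needs.
record Core {R : Rel A 0ℓ} (R? : Decidable₂ R) (p q : ℕ) (X Y : List A) : Set where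
  field
    X′ Y′    : List A
    X′⊆X     : X′ ⊆ X
    Y′⊆Y     : Y′ ⊆ Y
    X′-uniq  : Unique X′
    Y′-uniq  : Unique Y′
    nonempty : ∃ (_∈ X′)
    degˣ     : ∀ {x} → x ∈ X′ → p < # (R? x) Y′
    degʸ     : ∀ {y} → y ∈ Y′ → q < # (flip R? y) X′

pairs-flip : {R : Rel A 0ℓ} (R? : Decidable₂ R) → ∀ xs ys →
             pairs R? xs ys ≡ pairs (flip R?) ys xs
pairs-flip R? xs ys = begin
  ∑ xs (λ x → # (R? x) ys)               ≡⟨ ∑-cong xs (λ x → #-∑ (R? x) ys) ⟩
  ∑ xs (λ x → ∑ ys λ y → ⟦ R? x y ⟧)     ≡⟨ ∑-swap xs ys ⟩
  ∑ ys (λ y → ∑ xs λ x → ⟦ R? x y ⟧)     ≡⟨ ∑-cong ys (λ y → #-∑ (flip R? y) xs) ⟨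
  ∑ ys (λ y → # (flip R? y) xs)          ∎
  where open ≡-Reasoning

private
  -- Deleting an entry lowers the required bound by exactly `p`, but costs only `d ≤ p` pairs. The
  -- summand `b` belongs to the untouched list.
  drop-light : ∀ {p a b d E} → d ≤ p → p * suc a + b < d + E → p * a + b < E
  drop-light {p} {a} {b} {d} {E} d≤p lt = +-cancelˡ-< p _ _ (begin-strict
    p + (p * a + b)  ≡⟨ rearrange p a b ⟩
    p * suc a + b    <⟨ lt ⟩
    d + E            ≤⟨ +-monoˡ-≤ E d≤p ⟩
    p + E            ∎)
    where
    open ≤-Reasoning
    rearrange : ∀ p a b → p + (p * a + b) ≡ p * suc a + b
    rearrange = solve-∀

-- Deleting a vertex of too small degree preserves the density hypothesis, so
-- repeated deletion stops at a non-empty core.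

core : ∀ {R : Rel A 0ℓ} (R? : Decidable₂ R) p q s X Y → length X + length Y ≤ s →
       Unique X → Unique Y → p * length X + q * length Y < pairs R? X Y → Core R? p q X Y
-- Without entries in `X` there are no pairs, so density fails; hence the core is non-empty.
core R? p q s [] Y _ _ _ ()
-- The bound `s` on the total size falls with each deletion and makes the recursion structural.
core R? p q (suc s) X@(x ∷ _) Y size uX uY dense
  with any? (λ x → # (R? x) Y ≤? p) X | any? (λ y → # (flip R? y) X ≤? q) Y
... | no degˣ | no degʸ = record
  { X′ = X ; Y′ = Y ; X′⊆X = id ; Y′⊆Y = id ; X′-uniq = uX ; Y′-uniq = uY
  ; nonempty = x , here refl
  ; degˣ = λ x∈X → ≰⇒> λ d≤p → degˣ (lose x∈X d≤p)
  ; degʸ = λ y∈Y → ≰⇒> λ d≤q → degʸ (lose y∈Y d≤q)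
  }
... | yes light | _ = record { Core C ; X′⊆X = remove⊆ light ∘ Core.X′⊆X C }
  where
  C = core R? p q s (X ─ light) Y
    (s≤s⁻¹ (subst (λ a → a + length Y ≤ suc s) (length-remove light) size))
    (Unique-remove light uX) uY
    (drop-light (lookup-result light)
      (subst₂ (λ a e → p * a + q * length Y < e) (length-remove light)
        (∑-remove (λ x → # (R? x) Y) light) dense))
... | no _ | yes light = record { Core C ; Y′⊆Y = remove⊆ light ∘ Core.Y′⊆Y C }
  where
  -- The pairs are counted from the side of `Y`, which turns this case into the previous one.
  dense′ : p * length X + q * length (Y ─ light) < pairs R? X (Y ─ light)
  dense′ = subst₂ _<_ (+-comm (q * length (Y ─ light)) (p * length X))
    (sym (pairs-flip R? X (Y ─ light)))
    (drop-light (lookup-result light)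
      (subst₂ _<_
        (trans (+-comm (p * length X) (q * length Y))
          (cong (λ b → q * b + p * length X) (length-remove light)))
        (trans (pairs-flip R? X Y) (∑-remove (λ y → # (flip R? y) X) light)) dense))
  C = core R? p q s X (Y ─ light)
    (s≤s⁻¹ (subst (_≤ suc s)
      (trans (cong (length X +_) (length-remove light)) (+-suc (length X) _)) size))
    uX (Unique-remove light uY) dense′

-- Copies of a graph from embeddings; cycles from closed lists of vertices.

module _ {P : Fin n → Set} (P? : ∀ j → Dec (P j)) where

  ∈-tabulate⁺ : ∀ {j} → P j → j ∈ₛ tabulate (does ∘ P?)
  ∈-tabulate⁺ {j} p = lookup⇒[]= j _ (trans (lookup∘tabulate _ j) (dec-true (P? j) p))

  ∈-tabulate⁻ : ∀ {j} → j ∈ₛ tabulate (does ∘ P?) → P j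
  ∈-tabulate⁻ {j} j∈ with P? j | trans (sym (lookup∘tabulate (does ∘ P?) j)) ([]=⇒lookup j∈)
  ... | yes p | _  = p
  ... | no  _ | ()

Adj-fromRel⁺ : {R : Rel (Fin n) 0ℓ} (R? : Decidable₂ R) → ∀ {i j} →
               ¬ i ≡ j → R i j ⊎ R j i → Adj (fromRel R?) i j
Adj-fromRel⁺ {suc n} R? {zero}  {zero}  i≢j _ = ⊥-elim (i≢j refl)
Adj-fromRel⁺ {suc n} R? {zero}  {suc j} _   r =
  ∈-tabulate⁺ (λ j → R? zero (suc j) ⊎-dec R? (suc j) zero) r
Adj-fromRel⁺ {suc n} R? {suc i} {zero}  _   r =
  ∈-tabulate⁺ (λ j → R? zero (suc j) ⊎-dec R? (suc j) zero) (swap r)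
Adj-fromRel⁺ {suc n} R? {suc i} {suc j} i≢j r =
  Adj-fromRel⁺ (λ i j → R? (suc i) (suc j)) (i≢j ∘ cong suc) r

Adj-fromRel⁻ : {R : Rel (Fin n) 0ℓ} (R? : Decidable₂ R) → ∀ {i j} →
               Adj (fromRel R?) i j → R i j ⊎ R j i
Adj-fromRel⁻ {suc n} R? {zero}  {suc j} a =
  ∈-tabulate⁻ (λ j → R? zero (suc j) ⊎-dec R? (suc j) zero) a
Adj-fromRel⁻ {suc n} R? {suc i} {zero}  a =
  swap (∈-tabulate⁻ (λ j → R? zero (suc j) ⊎-dec R? (suc j) zero) a)
Adj-fromRel⁻ {suc n} R? {suc i} {suc j} a = Adj-fromRel⁻ (λ i j → R? (suc i) (suc j)) a

-- Subgraphs need not be induced, so the copy takes as edges only the images of edges of `H`.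
-- Injectivity of `f` then makes adjacency in the copy reflect adjacency in `H`.
embedding⇒count≢0 : (H : Graph h) (G : Graph n) (f : Fin h → Fin n) →
                    (∀ {i j} → f i ≡ f j → i ≡ j) →
                    (∀ {i j} → Adj H i j → Adj G (f i) (f j)) → ¬ count H G ≡ 0
embedding⇒count≢0 {h} {n} H G f inj hom count≡0 =
  n≮0 (subst (0 <_) count≡0 (∈-length (∈-filter⁺ (λ S → (S ⊑? G) ×-dec (H ≅? S))
    (∈-cartesianProduct⁺ (∈-allSubsets V) (∈-allGraphs E)) (sub , φ , iso))))
  where
  φ = tabulate f
  V? = λ v → Fin.any? λ i → Vec.lookup φ i Fin.≟ v
  V = tabulate (does ∘ V?)
  Image : Rel (Fin n) 0ℓ
  Image u v = ∃ λ i → ∃ λ j → f i ≡ u × f j ≡ v × Adj H i j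
  Image? : Decidable₂ Image
  Image? u v = Fin.any? λ i → Fin.any? λ j → (f i Fin.≟ u) ×-dec (f j Fin.≟ v) ×-dec adj? H i j
  E = fromRel Image?

  f≡φ : ∀ i → Vec.lookup φ i ≡ f i
  f≡φ = lookup∘tabulate f

  ∈V : ∀ i → f i ∈ₛ V
  ∈V i = ∈-tabulate⁺ V? (i , f≡φ i)

  sub : (V , E) ⊑ G
  sub u v a with Adj-fromRel⁻ Image? a
  ... | inj₁ (i , j , refl , refl , b) = hom b , ∈V i , ∈V j
  ... | inj₂ (i , j , refl , refl , b) = hom (Adj-sym H b) , ∈V j , ∈V i

  injᵩ : ∀ i j → Vec.lookup φ i ≡ Vec.lookup φ j → i ≡ j
  injᵩ i j e = inj (trans (sym (f≡φ i)) (trans e (f≡φ j)))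

  pull : ∀ i j → Image (Vec.lookup φ i) (Vec.lookup φ j) → Adj H i j
  pull i j (a , b , p , q , e) =
    subst₂ (Adj H) (inj (trans p (f≡φ i))) (inj (trans q (f≡φ j))) e

  iso : IsIso H (V , E) φ
  iso = injᵩ
      , (λ v → mk⇔ (∈-tabulate⁻ V?) (∈-tabulate⁺ V?))
      , (λ i j → mk⇔
          (λ a → Adj-fromRel⁺ Image?
            (λ e → Adj-irrefl H j (subst (λ i → Adj H i j) (injᵩ i j e) a))
            (inj₁ (i , j , sym (f≡φ i) , sym (f≡φ j) , a)))
          (λ a → [ pull i j , Adj-sym H ∘ pull j i ]′ (Adj-fromRel⁻ Image? a)))

Linked-lookup : ∀ {A : Set} {R : Rel A 0ℓ} {xs} → Linked R xs → ∀ (i j : Fin (length xs)) →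
                suc (toℕ i) ≡ toℕ j → R (lookup xs i) (lookup xs j)
Linked-lookup (r ∷ _) zero    (suc zero) _ = r
Linked-lookup (_ ∷ l) (suc i) (suc j)    e = Linked-lookup l i j (suc-injective e)

lookup-injective : ∀ {A : Set} {xs : List A} → Unique xs → ∀ i j →
                   lookup xs i ≡ lookup xs j → i ≡ j
lookup-injective (_  ∷ _) zero    zero    _ = refl
lookup-injective (x∉ ∷ _) zero    (suc j) e = ⊥-elim (All.lookup x∉ (∈-lookup j) e)
lookup-injective (x∉ ∷ _) (suc i) zero    e = ⊥-elim (All.lookup x∉ (∈-lookup i) (sym e))
lookup-injective (_  ∷ u) (suc i) (suc j) e = cong suc (lookup-injective u i j e)

Adj-cycle⁻ : ∀ {k} {i j : Fin (suc k)} → Adj (cycle (suc k)) i j →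
             suc (toℕ i) % suc k ≡ toℕ j ⊎ suc (toℕ j) % suc k ≡ toℕ i
Adj-cycle⁻ {k} = Adj-fromRel⁻ λ i j →
  let instance _ = Fin.nonZeroIndex i in suc (toℕ i) % suc k ≟ℕ toℕ j

-- The successor modulo the length is the next position in the list, except at the last position,
-- where it wraps to the head and `closed` supplies the edge.
cycle⇒count≢0 : (G : Graph n) → ∀ {k x xs} → suc (length xs) ≡ k → Unique (x ∷ xs) →
                Linked (Adj G) (x ∷ xs) →
                (∀ i → toℕ i ≡ length xs → Adj G (lookup (x ∷ xs) i) x) →
                ¬ count (cycle k) G ≡ 0
cycle⇒count≢0 G {x = x} {xs} refl uniq linked closed =
  embedding⇒count≢0 (cycle (suc (length xs))) G (lookup (x ∷ xs)) (lookup-injective uniq _ _)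
    λ {i} {j} a → [ hom i j , Adj-sym G ∘ hom j i ]′ (Adj-cycle⁻ {i = i} {j} a)
  where
  K = suc (length xs)
  hom : ∀ i j → suc (toℕ i) % K ≡ toℕ j → Adj G (lookup (x ∷ xs) i) (lookup (x ∷ xs) j)
  hom i j e with suc (toℕ i) <? K
  ... | yes i<K = Linked-lookup linked i j (trans (sym (m<n⇒m%n≡m i<K)) e)
  ... | no  i≮K = subst (λ j → Adj G (lookup (x ∷ xs) i) (lookup (x ∷ xs) j)) 0≡j
                    (closed i (suc-injective i≡K))
    where
    i≡K : suc (toℕ i) ≡ K
    i≡K = ≤-antisym (Fin.toℕ<n i) (≮⇒≥ i≮K)
    0≡j : zero ≡ j
    0≡j = Fin.toℕ-injective (trans (sym (trans (cong (_% K) i≡K) (n%n≡0 K))) e)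


-- Greedy construction of an even cycle through a vertex.

module _ {n : ℕ} where
  open DecMembership (Fin._≟_ {n}) public using (_∈?_)

-- Pigeonhole: if every candidate were in `vs`, a duplicate-free list would be contained in a
-- shorter one.
avoid : {P : Pred (Fin n) 0ℓ} (P? : Decidable P) → ∀ {ys} vs → Unique ys →
        length vs < # P? ys → ∃ λ y → y ∈ ys × P y × y ∉ vs
avoid P? {ys} vs u many with any? (λ y → ¬? (y ∈? vs)) (filter P? ys)
... | yes p = let y , y∈ , y∉ = find p ; y∈ys , Py = ∈-filter⁻ P? {xs = ys} y∈ in y , y∈ys , Py , y∉
... | no ¬p = ⊥-elim (<⇒≱ many (Unique-⊆⇒≤ (Unique.filter⁺ P? u)
                λ {y} y∈ → decidable-stable (y ∈? vs) (¬p ∘ lose y∈)))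

-- The path alternates between `X` and `Y`. Each extension has to avoid everything used so far, so
-- the two lists may overlap. The bounds by `k` suffice because the last path has `k` vertices
-- chosen in `Y` and, before its last extension, at most `k` chosen in `X`.
module _ (G : Graph n) (v : Fin n) {X Y : List (Fin n)} (k : ℕ)
  (X-nbrs : ∀ {x} → x ∈ X → Adj G v x) (start : ∃ (_∈ X))
  (extendʸ : ∀ {x} xs ys → x ∈ X → xs ⊆ X → ys ⊆ Y → length xs ≤ k → length ys ≤ k →
             ∃ λ y → y ∈ Y × Adj G x y × y ∉ v ∷ xs ++ ys)
  (extendˣ : ∀ {y} xs ys → y ∈ Y → xs ⊆ X → ys ⊆ Y → length xs ≤ k → length ys ≤ k →
             ∃ λ x → x ∈ X × Adj G x y × x ∉ v ∷ xs ++ ys)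
  where

  -- The path is kept with its newest vertex first; its last vertex is v, to
  -- which every vertex of X is adjacent, so that it closes up to a cycle.

  record Zigzag (j : ℕ) : Set where
    field
      head    : Fin n
      rest    : List (Fin n)
      xs ys   : List (Fin n)
      head∈X  : head ∈ X
      xs⊆X    : xs ⊆ X
      ys⊆Y    : ys ⊆ Y
      |xs|    : length xs ≡ suc j
      |ys|    : length ys ≡ j
      |rest|  : length rest ≡ suc (2 * j)
      uniq    : Unique (head ∷ rest)
      linked  : Linked (Adj G) (head ∷ rest)
      covered : head ∷ rest ⊆ v ∷ xs ++ ys
      last    : ∀ i → toℕ i ≡ length rest → lookup (head ∷ rest) i ≡ v

  zigzag : ∀ j → j ≤ k → Zigzag j
  zigzag zero _ = record
    { head = x ; rest = v ∷ [] ; xs = x ∷ [] ; ys = [] ; head∈X = x∈X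
    ; xs⊆X = λ { (here refl) → x∈X } ; ys⊆Y = λ () ; |xs| = refl ; |ys| = refl ; |rest| = refl
    ; uniq = (x≢v ∷ []) ∷ [] ∷ [] ; linked = Adj-sym G (X-nbrs x∈X) ∷ [-]
    ; covered = λ { (here e) → there (here e) ; (there (here e)) → here e }
    ; last = λ { (suc zero) _ → refl } }
    where
    x = proj₁ start
    x∈X = proj₂ start
    x≢v : ¬ x ≡ v
    x≢v refl = Adj-irrefl G v (X-nbrs x∈X)
  zigzag (suc j) j<k = record
    { head = x ; rest = y ∷ Z.head ∷ Z.rest ; xs = x ∷ Z.xs ; ys = y ∷ Z.ys ; head∈X = x∈X
    ; xs⊆X = λ { (here refl) → x∈X ; (there p) → Z.xs⊆X p }
    ; ys⊆Y = ys⊆Y ; |xs| = cong suc Z.|xs| ; |ys| = cong suc Z.|ys|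
    ; |rest| = trans (cong (2 +_) Z.|rest|) (rearrange j)
    -- Freshness with respect to `v`, `xs` and `ys` passes to the path itself through `covered`.
    ; uniq = ¬Any⇒All¬ _ (x∉ ∘ [y]) ∷ ¬Any⇒All¬ _ (y∉ ∘ Z.covered) ∷ Z.uniq
    ; linked = x~y ∷ Adj-sym G h~y ∷ Z.linked
    ; covered = λ { (here e) → there (here e) ; (there p) → weaken ([y] p) }
    ; last = λ { (suc (suc i)) e → Z.last i (suc-injective (suc-injective e)) }
    }
    where
    module Z = Zigzag (zigzag j (<⇒≤ j<k))
    |xs|≤k : length Z.xs ≤ k
    |xs|≤k = subst (_≤ k) (sym Z.|xs|) j<k
    step-y = extendʸ Z.xs Z.ys Z.head∈X Z.xs⊆X Z.ys⊆Y |xs|≤k (subst (_≤ k) (sym Z.|ys|) (<⇒≤ j<k))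
    y = proj₁ step-y
    y∈Y = proj₁ (proj₂ step-y)
    h~y = proj₁ (proj₂ (proj₂ step-y))
    y∉ = proj₂ (proj₂ (proj₂ step-y))
    ys⊆Y : y ∷ Z.ys ⊆ Y
    ys⊆Y (here refl) = y∈Y
    ys⊆Y (there p)   = Z.ys⊆Y p
    -- The new `y` already counts as used, so both lists have `suc j` entries, still at most `k`.
    step-x = extendˣ Z.xs (y ∷ Z.ys) y∈Y Z.xs⊆X ys⊆Y |xs|≤k
               (subst (_≤ k) (cong suc (sym Z.|ys|)) j<k)
    x = proj₁ step-x
    x∈X = proj₁ (proj₂ step-x)
    x~y = proj₁ (proj₂ (proj₂ step-x))
    x∉ = proj₂ (proj₂ (proj₂ step-x))
    insert : Z.xs ++ Z.ys ⊆ Z.xs ++ y ∷ Z.ys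
    insert = [ ∈-++⁺ˡ , ∈-++⁺ʳ Z.xs ∘ there ]′ ∘ ∈-++⁻ Z.xs
    [y] : y ∷ Z.head ∷ Z.rest ⊆ v ∷ Z.xs ++ y ∷ Z.ys
    [y] (here e)  = there (∈-++⁺ʳ Z.xs (here e))
    [y] (there p) with Z.covered p
    ... | here e  = here e
    ... | there q = there (insert q)
    weaken : v ∷ Z.xs ++ y ∷ Z.ys ⊆ v ∷ x ∷ Z.xs ++ y ∷ Z.ys
    weaken (here e)  = here e
    weaken (there p) = there (there p)
    rearrange : ∀ j → 2 + suc (2 * j) ≡ suc (2 * suc j)
    rearrange = solve-∀

  -- After `k` rounds the path consists of `v`, `suc k` vertices chosen in `X` and `k` chosen in
  -- `Y`, and its newest vertex, being in `X`, is adjacent to `v`.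
  zigzag⇒count≢0 : ¬ count (cycle (2 * suc k)) G ≡ 0
  zigzag⇒count≢0 = cycle⇒count≢0 G {2 * suc k} {Z.head} {Z.rest}
    (trans (cong suc Z.|rest|) (rearrange k)) Z.uniq Z.linked λ i e →
      subst (λ u → Adj G u Z.head) (sym (Z.last i e)) (X-nbrs Z.head∈X)
    where
    module Z = Zigzag (zigzag k ≤-refl)
    rearrange : ∀ k → suc (suc (2 * k)) ≡ 2 * suc k
    rearrange = solve-∀

-- Degrees of the neighbours of a vertex in a graph without the cycle.

nbrs : Graph n → Fin n → List (Fin n)
nbrs {n} G v = filter (adj? G v) (allFin n)

-- The length of a walk is its number of edges, and repeated vertices are allowed.
walks# : Graph n → ℕ → Fin n → ℕ
walks# G zero    v = 1
walks# G (suc j) v = ∑ (nbrs G v) (walks# G j)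

deg : Graph n → Fin n → ℕ
deg G v = length (nbrs G v)

module _ (G : Graph n) (k : ℕ) (cycle-free : count (cycle (2 * suc k)) G ≡ 0) (v : Fin n) where

  private
    N M : List (Fin n)
    N = nbrs G v
    M = filter (¬? ∘ adj? G v) (allFin n)

    N-uniq : Unique N
    N-uniq = Unique.filter⁺ (adj? G v) (Unique.allFin⁺ n)
    M-uniq : Unique M
    M-uniq = Unique.filter⁺ (¬? ∘ adj? G v) (Unique.allFin⁺ n)

    N-adj : ∀ {x} → x ∈ N → Adj G v x
    N-adj = proj₂ ∘ ∈-filter⁻ (adj? G v) {xs = allFin n}
    M-nadj : ∀ {x} → x ∈ M → ¬ Adj G v x
    M-nadj = proj₂ ∘ ∈-filter⁻ (¬? ∘ adj? G v) {xs = allFin n}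

  -- The thresholds are the greatest numbers of vertices to be avoided: v and k
  -- vertices of M when leaving N, but only k vertices of N when leaving M (k is
  -- the k − 1 of the theorem).

  cross-pairs : pairs (adj? G) N M ≤ suc k * length N + k * length M
  cross-pairs = ≮⇒≥ λ dense →
    let open Core (core (adj? G) (suc k) k _ N M ≤-refl N-uniq M-uniq dense) in
    zigzag⇒count≢0 G v k (N-adj ∘ X′⊆X) nonempty
      -- A vertex of `M` is never in `xs`, which consists of neighbours of `v`; but `v` itself lies
      -- in `M` and must be excluded explicitly.
      (λ {x} xs ys x∈ xs⊆ ys⊆ _ |ys| →
        let y , y∈ , x~y , y∉ =
              avoid (adj? G x) (v ∷ ys) Y′-uniq (<-≤-trans (s≤s (s≤s |ys|)) (degˣ x∈))
        in y , y∈ , x~y , λ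
          { (here e)  → y∉ (here e)
          ; (there p) →
              [ (λ q → M-nadj (Y′⊆Y y∈) (N-adj (X′⊆X (xs⊆ q)))) , y∉ ∘ there ]′ (∈-++⁻ xs p) })
      (λ {y} xs ys y∈ xs⊆ ys⊆ |xs| _ →
        let x , x∈ , x~y , x∉ = avoid (λ x → adj? G x y) xs X′-uniq (<-≤-trans (s≤s |xs|) (degʸ y∈))
        in x , x∈ , x~y , λ
          { (here e)  → Adj-irrefl G v (subst (Adj G v) e (N-adj (X′⊆X x∈)))
          ; (there p) → [ x∉ , (λ q → M-nadj (Y′⊆Y (ys⊆ q)) (N-adj (X′⊆X x∈))) ]′ (∈-++⁻ xs p) })
      cycle-free

  -- Both sides of the core lie in `N` and may share vertices, so either kind of extension avoids
  -- `v` and up to `k` vertices from each side.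
  inner-pairs : pairs (adj? G) N N ≤ suc (k + k) * length N + suc (k + k) * length N
  inner-pairs = ≮⇒≥ λ dense →
    let open Core (core (adj? G) (suc (k + k)) (suc (k + k)) _ N N ≤-refl N-uniq N-uniq dense)
        few : ∀ xs ys → length xs ≤ k → length ys ≤ k → length (v ∷ xs ++ ys) ≤ suc (k + k)
        few xs ys |xs| |ys| = s≤s (≤-trans (≤-reflexive (length-++ xs)) (+-mono-≤ |xs| |ys|))
    in
    zigzag⇒count≢0 G v k (N-adj ∘ X′⊆X) nonempty
      (λ {x} xs ys x∈ _ _ |xs| |ys| →
        avoid (adj? G x) (v ∷ xs ++ ys) Y′-uniq
          (<-≤-trans (s≤s (few xs ys |xs| |ys|)) (degˣ x∈)))
      (λ {y} xs ys y∈ _ _ |xs| |ys| →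
        avoid (λ x → adj? G x y) (v ∷ xs ++ ys) X′-uniq
          (<-≤-trans (s≤s (few xs ys |xs| |ys|)) (degʸ y∈)))
      cycle-free

  -- Each degree is split into neighbours inside and outside `N`. The main term `k * n` comes only
  -- from the threshold `k` on the side of `M`; all other contributions are multiples of `deg G v`.
  ∑-deg-nbrs≤ : ∑ (nbrs G v) (deg G) ≤ k * n + (suc k + 2 * suc (k + k)) * deg G v
  ∑-deg-nbrs≤ = begin
    ∑ N (deg G)
      ≡⟨ ∑-cong N (λ u → #-split (adj? G u) (adj? G v) (allFin n)) ⟩
    ∑ N (λ u → # (adj? G u) N + # (adj? G u) M)
      ≡⟨ ∑-+ N ⟩
    pairs (adj? G) N N + pairs (adj? G) N M
      ≤⟨ +-mono-≤ inner-pairs cross-pairs ⟩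
    suc (k + k) * d + suc (k + k) * d + (suc k * d + k * length M)
      ≤⟨ +-monoʳ-≤ (suc (k + k) * d + suc (k + k) * d) (+-monoʳ-≤ (suc k * d) (*-monoʳ-≤ k |M|≤n)) ⟩
    suc (k + k) * d + suc (k + k) * d + (suc k * d + k * n)
      ≡⟨ rearrange k d n ⟩
    k * n + (suc k + 2 * suc (k + k)) * d ∎
    where
    open ≤-Reasoning
    d = deg G v
    |M|≤n : length M ≤ n
    |M|≤n = ≤-trans (length-filter (¬? ∘ adj? G v) (allFin n)) (≤-reflexive (length-tabulate id))
    rearrange : ∀ k d n → suc (k + k) * d + suc (k + k) * d + (suc k * d + k * n)
                        ≡ k * n + (suc k + 2 * suc (k + k)) * d
    rearrange = solve-∀

-- Estimates for square roots and powers.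

√-floor : ∀ q → ∃ λ s → s * s ≤ q × q < suc s * suc s
√-floor zero    = 0 , z≤n , s≤s z≤n
√-floor (suc q) with √-floor q
... | s , s²≤q , q<s⁺² with suc q <? suc s * suc s
...   | yes lt = s , m≤n⇒m≤1+n s²≤q , lt
...   | no ≮  = suc s , ≮⇒≥ ≮ , (begin-strict
  suc q                   ≤⟨ q<s⁺² ⟩
  suc s * suc s           <⟨ *-mono-< (n<1+n (suc s)) (n<1+n (suc s)) ⟩
  suc (suc s) * suc (suc s) ∎)
  where open ≤-Reasoning

-- This is (1 + D/s)^j ≤ 1 + E/s without division, where `E` is independent of `s`.
shifted-power : ∀ D j → ∃ λ E → ∀ s → 1 ≤ s → s * (s + D) ^ j ≤ (s + E) * s ^ j
shifted-power D zero    = 0 , λ s _ → ≤-reflexive (cong (_* 1) (sym (+-identityʳ s)))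
shifted-power D (suc j) with shifted-power D j
-- From (s + D)(s + E) = s² + (D + E)s + DE and DE ≤ DEs.
... | E , ih = D + E + D * E , λ s 1≤s → begin
  s * ((s + D) * (s + D) ^ j)
    ≡⟨ assoc₁ s (s + D) _ ⟩
  (s + D) * (s * (s + D) ^ j)
    ≤⟨ *-monoʳ-≤ (s + D) (ih s 1≤s) ⟩
  (s + D) * ((s + E) * s ^ j)
    ≡⟨ assoc₂ s D E (s ^ j) ⟩
  (s * s + (D + E) * s + D * E * 1) * s ^ j
    ≤⟨ *-monoˡ-≤ (s ^ j) (+-monoʳ-≤ (s * s + (D + E) * s) (*-monoʳ-≤ (D * E) 1≤s)) ⟩
  (s * s + (D + E) * s + D * E * s) * s ^ j
    ≡⟨ assoc₃ s D E (s ^ j) ⟩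
  (s + (D + E + D * E)) * (s * s ^ j) ∎
  where
  open ≤-Reasoning
  assoc₁ : ∀ a b c → a * (b * c) ≡ b * (a * c)
  assoc₁ = solve-∀
  assoc₂ : ∀ s D E t → (s + D) * ((s + E) * t) ≡ (s * s + (D + E) * s + D * E * 1) * t
  assoc₂ = solve-∀
  assoc₃ : ∀ s D E t → (s * s + (D + E) * s + D * E * s) * t ≡ (s + (D + E + D * E)) * (s * t)
  assoc₃ = solve-∀

-- Once s ≥ mE, the error E/s is at most 1/m. The extra `suc` in the threshold makes `s` positive,
-- so that it can be cancelled.
shifted-power-asymptotic : ∀ m D j → ∃ λ S → ∀ s → S ≤ s → m * (s + D) ^ j ≤ suc m * s ^ j
shifted-power-asymptotic m D j with shifted-power D j
... | E , bound = suc (m * E) , large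
  where
  open ≤-Reasoning
  assoc₁ : ∀ s m t → s * (m * t) ≡ m * (s * t)
  assoc₁ = solve-∀
  assoc₂ : ∀ m s E t → m * ((s + E) * t) ≡ (m * s + m * E) * t
  assoc₂ = solve-∀
  assoc₃ : ∀ m s t → (m * s + s) * t ≡ s * (suc m * t)
  assoc₃ = solve-∀
  large : ∀ s → suc (m * E) ≤ s → m * (s + D) ^ j ≤ suc m * s ^ j
  large s@(suc _) S≤s = *-cancelˡ-≤ s (begin
    s * (m * (s + D) ^ j)     ≡⟨ assoc₁ s m _ ⟩
    m * (s * (s + D) ^ j)     ≤⟨ *-monoʳ-≤ m (bound s (s≤s z≤n)) ⟩
    m * ((s + E) * s ^ j)     ≡⟨ assoc₂ m s E (s ^ j) ⟩
    (m * s + m * E) * s ^ j   ≤⟨ *-monoˡ-≤ (s ^ j) (+-monoʳ-≤ (m * s) (<⇒≤ S≤s)) ⟩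
    (m * s + s) * s ^ j       ≡⟨ assoc₃ m s (s ^ j) ⟩
    s * (suc m * s ^ j)       ∎)

2*m*n≤m²+n² : ∀ m n → 2 * (m * n) ≤ m * m + n * n
2*m*n≤m²+n² zero    n       = z≤n
2*m*n≤m²+n² (suc m) zero    = ≤-trans (≤-reflexive (cong (2 *_) (*-zeroʳ m))) z≤n
2*m*n≤m²+n² (suc m) (suc n) = begin
  2 * (suc m * suc n)                ≡⟨ lhs m n ⟩
  2 * (m * n) + (2 * m + 2 * n + 2)  ≤⟨ +-monoˡ-≤ _ (2*m*n≤m²+n² m n) ⟩
  m * m + n * n + (2 * m + 2 * n + 2) ≡⟨ rhs m n ⟩
  suc m * suc m + suc n * suc n      ∎
  where
  open ≤-Reasoning
  lhs : ∀ m n → 2 * (suc m * suc n) ≡ 2 * (m * n) + (2 * m + 2 * n + 2)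
  lhs = solve-∀
  rhs : ∀ m n → m * m + n * n + (2 * m + 2 * n + 2) ≡ suc m * suc m + suc n * suc n
  rhs = solve-∀

^-distribʳ-* : ∀ a b j → (a * b) ^ j ≡ a ^ j * b ^ j
^-distribʳ-* a b zero    = refl
^-distribʳ-* a b (suc j) =
  trans (cong (a * b *_) (^-distribʳ-* a b j)) (rearrange a b (a ^ j) (b ^ j))
  where
  rearrange : ∀ a b c d → a * b * (c * d) ≡ a * c * (b * d)
  rearrange = solve-∀

-- Bounds on the number of walks.

∑-filter : {P : Pred A 0ℓ} (P? : Decidable P) → ∀ xs {f : A → ℕ} →
           ∑ (filter P? xs) f ≡ ∑ xs (λ x → f x * ⟦ P? x ⟧)
∑-filter P? []           = refl
∑-filter P? (x ∷ xs) {f} with P? x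
... | yes _ = cong₂ _+_ (sym (*-identityʳ (f x))) (∑-filter P? xs)
... | no  _ = trans (∑-filter P? xs) (cong (_+ ∑ xs (λ x → f x * ⟦ P? x ⟧)) (sym (*-zeroʳ (f x))))

⟦⟧-cong : ∀ {P Q : Set} (P? : Dec P) (Q? : Dec Q) → (P → Q) → (Q → P) → ⟦ P? ⟧ ≡ ⟦ Q? ⟧
⟦⟧-cong (yes _) (yes _) _   _   = refl
⟦⟧-cong (yes p) (no ¬q) p→q _   = ⊥-elim (¬q (p→q p))
⟦⟧-cong (no ¬p) (yes q) _   q→p = ⊥-elim (¬p (q→p q))
⟦⟧-cong (no _)  (no _)  _   _   = refl

-- In the double sum, the degree of `u` appears once for each neighbour of `u`.
∑-deg-nbrs : (G : Graph n) → ∑ (allFin n) (λ v → ∑ (nbrs G v) (deg G)) ≡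
                             ∑ (allFin n) (λ v → deg G v * deg G v)
∑-deg-nbrs {n} G = begin
  ∑ V (λ v → ∑ (nbrs G v) (deg G))
    ≡⟨ ∑-cong V (λ v → ∑-filter (adj? G v) V) ⟩
  ∑ V (λ v → ∑ V λ u → deg G u * ⟦ adj? G v u ⟧)
    ≡⟨ ∑-swap V V ⟩
  ∑ V (λ u → ∑ V λ v → deg G u * ⟦ adj? G v u ⟧)
    ≡⟨ ∑-cong V (λ u → ∑-* (deg G u) V) ⟩
  ∑ V (λ u → deg G u * ∑ V λ v → ⟦ adj? G v u ⟧)
    ≡⟨ ∑-cong V (λ u → cong (deg G u *_) (∑-cong V λ v →
         ⟦⟧-cong (adj? G v u) (adj? G u v) (Adj-sym G) (Adj-sym G))) ⟩
  ∑ V (λ u → deg G u * ∑ V λ v → ⟦ adj? G u v ⟧)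
    ≡⟨ ∑-cong V (λ u → cong (deg G u *_) (#-∑ (adj? G u) V)) ⟨
  ∑ V (λ u → deg G u * deg G u) ∎
  where
  open ≡-Reasoning
  V = allFin n

walks#-1 : (G : Graph n) → ∀ v → walks# G 1 v ≡ deg G v
walks#-1 G v = trans (∑-const (nbrs G v) 1) (*-identityʳ _)

∑-linear : ∀ xs a b {f g : A → ℕ} → ∑ xs (λ x → a * f x + b * g x) ≡ a * ∑ xs f + b * ∑ xs g
∑-linear xs a b = trans (∑-+ xs) (cong₂ _+_ (∑-* a xs) (∑-* b xs))

module _ (G : Graph n) (q C : ℕ)
  (two-step : ∀ v → ∑ (nbrs G v) (deg G) ≤ q + C * deg G v) where

  -- The hypothesis is the case of length 2; prepending one step, that is, summing over the
  -- neighbours of the start, preserves the inequality.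
  walks#-rec : ∀ j v → walks# G (2 + j) v ≤ q * walks# G j v + C * walks# G (1 + j) v
  walks#-rec zero v = begin
    ∑ (nbrs G v) (walks# G 1)        ≡⟨ ∑-cong (nbrs G v) (walks#-1 G) ⟩
    ∑ (nbrs G v) (deg G)             ≤⟨ two-step v ⟩
    q + C * deg G v                  ≡⟨ cong₂ _+_ (*-identityʳ q) (cong (C *_) (walks#-1 G v)) ⟨
    q * 1 + C * walks# G 1 v         ∎
    where open ≤-Reasoning
  walks#-rec (suc j) v = ≤-trans (∑-mono (nbrs G v) (walks#-rec j))
                                 (≤-reflexive (∑-linear (nbrs G v) q C))

  walks : ℕ → ℕ
  walks j = ∑ (allFin n) (walks# G j)

  walks-rec : ∀ j → walks (2 + j) ≤ q * walks j + C * walks (1 + j)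
  walks-rec j = ≤-trans (∑-mono (allFin n) (walks#-rec j))
                        (≤-reflexive (∑-linear (allFin n) q C))

  -- With m = C + e, the condition q + Cm ≤ m² becomes q ≤ me, free of subtraction.
  module _ (e : ℕ) .{{_ : NonZero e}} (q≤ : q ≤ (C + e) * e) where

    private
      m = C + e
      V = allFin n

      |V| : length V ≡ n
      |V| = length-tabulate id

      walks-0 : walks 0 ≡ n
      walks-0 = trans (∑-const V 1) (trans (*-identityʳ _) |V|)

      walks-1 : walks 1 ≡ ∑ V (deg G)
      walks-1 = ∑-cong V (walks#-1 G)

      walks-2 : walks 2 ≡ ∑ V (λ v → deg G v * deg G v)
      walks-2 = trans (∑-cong V λ v → ∑-cong (nbrs G v) (walks#-1 G)) (∑-deg-nbrs G)

    -- As 2m = (m + e) + C, the term C W_1 that the recurrence contributes to the bound on Σ d²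
    -- cancels. What remains is (m + e) W_1 ≤ (m + e) nm.
    walks-1≤ : walks 1 ≤ n * m
    walks-1≤ = *-cancelˡ-≤ (m + e) {{>-nonZero (≤-trans (>-nonZero⁻¹ e) (m≤n+m e m))}}
      (+-cancelʳ-≤ (C * walks 1) _ _ (begin
      (m + e) * walks 1 + C * walks 1
        ≡⟨ split C e (walks 1) ⟩
      2 * (m * walks 1)
        ≡⟨ cong (λ w → 2 * (m * w)) walks-1 ⟩
      2 * (m * ∑ V (deg G))
        ≡⟨ cong (2 *_) (∑-* m V) ⟨
      2 * ∑ V (λ v → m * deg G v)
        ≡⟨ ∑-* 2 V ⟨
      ∑ V (λ v → 2 * (m * deg G v))
        ≤⟨ ∑-mono V (λ v → 2*m*n≤m²+n² m (deg G v)) ⟩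
      ∑ V (λ v → m * m + deg G v * deg G v)
        ≡⟨ ∑-+ V ⟩
      ∑ V (λ _ → m * m) + ∑ V (λ v → deg G v * deg G v)
        ≡⟨ cong₂ _+_ (trans (∑-const V (m * m)) (cong (_* (m * m)) |V|)) (sym walks-2) ⟩
      n * (m * m) + walks 2
        ≤⟨ +-monoʳ-≤ (n * (m * m)) (walks-rec 0) ⟩
      n * (m * m) + (q * walks 0 + C * walks 1)
        ≤⟨ +-monoʳ-≤ (n * (m * m)) (+-monoˡ-≤ (C * walks 1) (*-mono-≤ q≤ (≤-reflexive walks-0))) ⟩
      n * (m * m) + (m * e * n + C * walks 1)
        ≡⟨ collect n m e (C * walks 1) ⟩
      (m + e) * (n * m) + C * walks 1 ∎))
      where
      open ≤-Reasoning
      split : ∀ C e w → (C + e + e) * w + C * w ≡ 2 * ((C + e) * w)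
      split = solve-∀
      collect : ∀ n m e w → n * (m * m) + (m * e * n + w) ≡ (m + e) * (n * m) + w
      collect = solve-∀

    -- Since me + Cm = m², the sequence n m^j satisfies with equality the recurrence that has `q`
    -- replaced by its bound me.
    walks≤ : ∀ j → walks j ≤ n * m ^ j
    walks≤ zero          = ≤-reflexive (trans walks-0 (sym (*-identityʳ n)))
    walks≤ (suc zero)    = ≤-trans walks-1≤ (≤-reflexive (cong (n *_) (sym (*-identityʳ m))))
    walks≤ (suc (suc j)) = begin
      walks (2 + j)
        ≤⟨ walks-rec j ⟩
      q * walks j + C * walks (1 + j)
        ≤⟨ +-mono-≤ (*-mono-≤ q≤ (walks≤ j)) (*-monoʳ-≤ C (walks≤ (suc j))) ⟩
      m * e * (n * m ^ j) + C * (n * (m * m ^ j))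
        ≡⟨ collect C e n (m ^ j) ⟩
      n * (m * (m * m ^ j)) ∎
      where
      open ≤-Reasoning
      collect : ∀ C e n t → (C + e) * e * (n * t) + C * (n * ((C + e) * t)) ≡
                            n * ((C + e) * ((C + e) * t))
      collect = solve-∀

-- Paths as walks traversed in two directions.

length-concatMap : (f : A → List B) → ∀ xs → length (concatMap f xs) ≡ ∑ xs (length ∘ f)
length-concatMap f []       = refl
length-concatMap f (x ∷ xs) =
  trans (length-++ (f x)) (cong (length (f x) +_) (length-concatMap f xs))

walksFrom : Graph n → ∀ j → Fin n → List (Vec (Fin n) (suc j))
walksFrom G zero    v = (v ∷ []) ∷ []
walksFrom G (suc j) v = concatMap (λ u → map (v ∷_) (walksFrom G j u)) (nbrs G v)

length-walksFrom : (G : Graph n) → ∀ j v → length (walksFrom G j v) ≡ walks# G j v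
length-walksFrom G zero    v = refl
length-walksFrom G (suc j) v = trans (length-concatMap _ (nbrs G v))
  (∑-cong (nbrs G v) λ u → trans (length-map (v ∷_) (walksFrom G j u)) (length-walksFrom G j u))

IsWalk : Graph n → Vec (Fin n) l → Set
IsWalk G φ = ∀ i j → suc (toℕ i) ≡ toℕ j → Adj G (Vec.lookup φ i) (Vec.lookup φ j)

∈-walksFrom : (G : Graph n) → ∀ j {v} {φ : Vec (Fin n) j} → IsWalk G (v ∷ φ) →
              v ∷ φ ∈ walksFrom G j v
∈-walksFrom G zero    {v} {[]}    _ = here refl
∈-walksFrom G (suc j) {v} {u ∷ φ} w =
  ∈-concatMap⁺ (λ u → map (v ∷_) (walksFrom G j u)) {xs = nbrs G v}
    (lose (∈-filter⁺ (adj? G v) (∈-allFin u) (w zero (suc zero) refl))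
          (∈-map⁺ (v ∷_) (∈-walksFrom G j λ a b e → w (suc a) (suc b) (cong suc e))))

allWalks : Graph n → ∀ j → List (Vec (Fin n) (suc j))
allWalks {n} G j = concatMap (walksFrom G j) (allFin n)

length-allWalks : (G : Graph n) → ∀ j → length (allWalks G j) ≡ ∑ (allFin n) (walks# G j)
length-allWalks {n} G j =
  trans (length-concatMap (walksFrom G j) (allFin n)) (∑-cong (allFin n) (length-walksFrom G j))

∈-allWalks : (G : Graph n) → ∀ j {φ : Vec (Fin n) (suc j)} → IsWalk G φ → φ ∈ allWalks G j
∈-allWalks {n} G j {v ∷ φ} w =
  ∈-concatMap⁺ (walksFrom G j) {xs = allFin n} (lose (∈-allFin v) (∈-walksFrom G j w))

-- List two different partners for every entry of `xs`. No partner is shared by different entries,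
-- so this list is free of duplicates, and it is contained in `ys`.
double-count : {P : A → B → Set} → (∀ {x x′ y} → P x y → P x′ y → x ≡ x′) →
               ∀ {xs} {ys : List B} → Unique xs →
               (∀ {x} → x ∈ xs → ∃₂ λ y y′ → P x y × P x y′ × ¬ y ≡ y′) →
               (∀ {x y} → x ∈ xs → P x y → y ∈ ys) → 2 * length xs ≤ length ys
double-count {A} {B} {P} det {xs} {ys} uniq two sub =
  let zs , u , src , len = list uniq two in
  subst (_≤ length ys) len (Unique-⊆⇒≤ u λ z∈ → let x , x∈ , Pxz = src z∈ in sub x∈ Pxz)
  where
  list : ∀ {xs} → Unique xs → (∀ {x} → x ∈ xs → ∃₂ λ y y′ → P x y × P x y′ × ¬ y ≡ y′) →
         ∃ λ zs → Unique zs × (∀ {z} → z ∈ zs → ∃ λ x → x ∈ xs × P x z) × length zs ≡ 2 * length xs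
  list {[]}     _        _   = [] , [] , (λ ()) , refl
  list {x ∷ xs} (x∉ ∷ u) two =
    let y , y′ , Py , Py′ , y≢y′ = two (here refl)
        zs , uz , src , len = list u (two ∘ there)
        fresh : ∀ {y} → P x y → All (λ z → ¬ y ≡ z) zs
        fresh Py = All.tabulate λ z∈ y≡z → let x′ , x′∈ , Px′z = src z∈ in
          All.lookup x∉ x′∈ (det (subst (P x) y≡z Py) Px′z)
    in y ∷ y′ ∷ zs
     , (y≢y′ ∷ fresh Py) ∷ fresh Py′ ∷ uz
     , (λ { (here e) → x , here refl , subst (P x) (sym e) Py
          ; (there (here e)) → x , here refl , subst (P x) (sym e) Py′
          ; (there (there z∈)) → let x′ , x′∈ , Px′z = src z∈ in x′ , there x′∈ , Px′z })
     , trans (cong (2 +_) len) (sym (*-suc 2 (length xs)))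

Adj-path : ∀ {l} {i j : Fin l} → Adj (path l) i j ⇔ (suc (toℕ i) ≡ toℕ j ⊎ suc (toℕ j) ≡ toℕ i)
Adj-path {l} {i} {j} = mk⇔ (Adj-fromRel⁻ R?) (λ r → Adj-fromRel⁺ R? (i≢j r) r)
  where
  R? = λ (i j : Fin l) → suc (toℕ i) ≟ℕ toℕ j
  i≢j : suc (toℕ i) ≡ toℕ j ⊎ suc (toℕ j) ≡ toℕ i → ¬ i ≡ j
  i≢j r i≡j = [ 1+n≢n , 1+n≢n ]′
    (subst (λ j → suc (toℕ i) ≡ toℕ j ⊎ suc (toℕ j) ≡ toℕ i) (sym i≡j) r)

opposite-suc : (i j : Fin l) → suc (toℕ i) ≡ toℕ j → suc (toℕ (opposite j)) ≡ toℕ (opposite i)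
opposite-suc {l} i j e = begin
  suc (toℕ (opposite j))  ≡⟨ cong suc (Fin.opposite-prop j) ⟩
  suc (l ∸ suc (toℕ j))   ≡⟨ +-∸-assoc 1 (Fin.toℕ<n j) ⟨
  l ∸ toℕ j               ≡⟨ cong (l ∸_) e ⟨
  l ∸ suc (toℕ i)         ≡⟨ Fin.opposite-prop i ⟨
  toℕ (opposite i)        ∎
  where open ≡-Reasoning

path-opposite : (i j : Fin l) → Adj (path l) i j → Adj (path l) (opposite i) (opposite j)
path-opposite i j a = Equivalence.from Adj-path
  ([ inj₂ ∘ opposite-suc i j , inj₁ ∘ opposite-suc j i ]′ (Equivalence.to Adj-path a))

reverse : Vec (Fin n) l → Vec (Fin n) l
reverse φ = tabulate (Vec.lookup φ ∘ opposite)

-- Reversing the order of positions is an involutive automorphism of the path, so composing with it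
-- keeps the image and the edges.
reverse-iso : ∀ {S : VE n} (φ : Vec (Fin n) l) → IsIso (path l) S φ → IsIso (path l) S (reverse φ)
reverse-iso {n} {l} {V , E} φ (inj , img , adj) = inj′ , img′ , adj′
  where
  rev : ∀ i → Vec.lookup (reverse φ) i ≡ Vec.lookup φ (opposite i)
  rev = lookup∘tabulate (Vec.lookup φ ∘ opposite)
  inj′ : ∀ i j → Vec.lookup (reverse φ) i ≡ Vec.lookup (reverse φ) j → i ≡ j
  inj′ i j e = begin
    i                      ≡⟨ Fin.opposite-involutive i ⟨
    opposite (opposite i)  ≡⟨ cong opposite (inj _ _ (trans (sym (rev i)) (trans e (rev j)))) ⟩
    opposite (opposite j)  ≡⟨ Fin.opposite-involutive j ⟩
    j                      ∎
    where open ≡-Reasoning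
  img′ : ∀ v → v ∈ₛ V ⇔ ∃ λ i → Vec.lookup (reverse φ) i ≡ v
  img′ v = mk⇔
    (λ v∈ → let i , e = Equivalence.to (img v) v∈ in
      opposite i ,
      trans (rev (opposite i)) (trans (cong (Vec.lookup φ) (Fin.opposite-involutive i)) e))
    (λ (i , e) → Equivalence.from (img v) (opposite i , trans (sym (rev i)) e))
  adj′ : ∀ i j → Adj (path l) i j ⇔ Adj E (Vec.lookup (reverse φ) i) (Vec.lookup (reverse φ) j)
  adj′ i j = mk⇔
    (λ a → subst₂ (Adj E) (sym (rev i)) (sym (rev j))
             (Equivalence.to (adj (opposite i) (opposite j)) (path-opposite i j a)))
    (λ a → subst₂ (Adj (path l)) (Fin.opposite-involutive i) (Fin.opposite-involutive j)
             (path-opposite (opposite i) (opposite j)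
               (Equivalence.from (adj (opposite i) (opposite j))
                 (subst₂ (Adj E) (rev i) (rev j) a))))

-- Equality at position 0 would identify the two ends of the path, which differ because it has at
-- least two vertices.
reverse≢ : ∀ {l} {S : VE n} (φ : Vec (Fin n) (2 + l)) → IsIso (path (2 + l)) S φ → ¬ φ ≡ reverse φ
reverse≢ φ (inj , _) e with inj zero (opposite zero)
  (trans (cong (λ φ → Vec.lookup φ zero) e) (lookup∘tabulate (Vec.lookup φ ∘ opposite) zero))
... | ()

-- The vertex set is the image of `φ`. Because `⊑` puts the ends of every edge into the vertex set,
-- each edge is the image under `φ` of an edge of `H`.
iso-determines : (H : Graph h) (G : Graph n) {S S′ : VE n} {φ : Vec (Fin n) h} →
                 S ⊑ G × IsIso H S φ → S′ ⊑ G × IsIso H S′ φ → S ≡ S′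
iso-determines H G {V , E} {V′ , E′} {φ} (sub , inj , img , adj) (sub′ , inj′ , img′ , adj′) =
  cong₂ _,_
    (⊆-antisym (λ {v} → Equivalence.from (img′ v) ∘ Equivalence.to (img v))
               (λ {v} → Equivalence.from (img v) ∘ Equivalence.to (img′ v)))
    (Adj-ext E E′ λ u v → mk⇔ (transfer E E′ (V , sub) img adj adj′ u v)
                              (transfer E′ E (V′ , sub′) img′ adj′ adj u v))
  where
  transfer : ∀ E E′ ((V , _) : ∃ λ V → (V , E) ⊑ G) →
             (∀ v → v ∈ₛ V ⇔ ∃ λ i → Vec.lookup φ i ≡ v) →
             (∀ i j → Adj H i j ⇔ Adj E (Vec.lookup φ i) (Vec.lookup φ j)) →
             (∀ i j → Adj H i j ⇔ Adj E′ (Vec.lookup φ i) (Vec.lookup φ j)) →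
             ∀ u v → Adj E u v → Adj E′ u v
  transfer E E′ (_ , sub) img adj adj′ u v a with sub u v a
  ... | _ , u∈ , v∈ with Equivalence.to (img u) u∈ | Equivalence.to (img v) v∈
  ...   | i , refl | j , refl = Equivalence.to (adj′ i j) (Equivalence.from (adj i j) a)

2*count-path≤walks : ∀ l (G : Graph n) →
                     2 * count (path (suc (suc l))) G ≤ ∑ (allFin n) (walks# G (suc l))
2*count-path≤walks {n} l G = subst (2 * count P G ≤_) (length-allWalks G (suc l))
  -- A copy is related to the vertex sequences that traverse it; one sequence and its reverse are
  -- the two partners.
  (double-count {P = λ S φ → S ⊑ G × IsIso P S φ}
    (λ {S} {S′} {φ} → iso-determines P G {S} {S′} {φ}) (copies-unique P G)
    (λ {S} S∈ → let S⊑G , φ , iso = proj₂ (∈-filter⁻ copy? {xs = candidates} S∈) in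
      φ , reverse φ , (S⊑G , iso) , (S⊑G , reverse-iso {S = S} φ iso) , reverse≢ {S = S} φ iso)
    (λ { {V , E} {φ} _ (S⊑G , _ , _ , adj) → ∈-allWalks G (suc l) {φ} λ i j e →
      proj₁ (S⊑G _ _ (Equivalence.to (adj i j) (Equivalence.from Adj-path (inj₁ e)))) }))
  where
  P = path (suc (suc l))
  copy? = λ S → (S ⊑? G) ×-dec (P ≅? S)
  candidates = cartesianProduct (allSubsets n) (allGraphs n)

-- Reduction of the rational bound to natural numbers.

square≤ : ∀ a b c t → suc b * suc b * (c * c) ≤ a * a * t →
          mkℚᵘ (ℤ.+ c) 0 ℚᵘ.* mkℚᵘ (ℤ.+ c) 0 ℚᵘ.≤
          mkℚᵘ (ℤ.+ a) b ℚᵘ.* mkℚᵘ (ℤ.+ a) b ℚᵘ.* mkℚᵘ (ℤ.+ t) 0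
-- The second argument of `mkℚᵘ` is the denominator less one, so the denominator being cleared is
-- `suc b`.
square≤ a b c t le = *≤* (subst₂ ℤ._≤_ lhs rhs (+≤+ (begin
  c * c * (suc b * suc b * 1)  ≡⟨ rearrange (c * c) (suc b * suc b) ⟩
  suc b * suc b * (c * c)      ≤⟨ le ⟩
  a * a * t                    ≡⟨ *-identityʳ (a * a * t) ⟨
  a * a * t * 1                ∎)))
  where
  open ≤-Reasoning
  rearrange : ∀ x y → x * (y * 1) ≡ y * x
  rearrange = solve-∀
  lhs : ℤ.+ (c * c * (suc b * suc b * 1)) ≡ ℤ.+ c ℤ.* ℤ.+ c ℤ.* ℤ.+ (suc b * suc b * 1)
  lhs = trans (ℤ.pos-* (c * c) (suc b * suc b * 1))
          (cong (ℤ._* ℤ.+ (suc b * suc b * 1)) (ℤ.pos-* c c))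
  rhs : ℤ.+ (a * a * t * 1) ≡ ℤ.+ a ℤ.* ℤ.+ a ℤ.* ℤ.+ t ℤ.* ℤ.+ 1
  rhs = trans (ℤ.pos-* (a * a * t) 1) (cong (ℤ._* ℤ.+ 1)
          (trans (ℤ.pos-* (a * a) t) (cong (ℤ._* ℤ.+ t) (ℤ.pos-* a a))))

module _ (p d : ℕ) .{co : Coprime (suc p) (suc d)} where

  private
    ε = mkℚ (ℤ.+ suc p) d co
    x = (1ℚ ℚ.+ ε) ℚ.* ½
    a b : ℕ
    -- Both are spelled as the unreduced value of (1 + ε)/2 computes, so that `x≃a/b` needs no
    -- arithmetic. Their values are a = d + p + 2 and b + 1 = 2(d + 1).
    a = suc ((d + 0 * suc d + suc (p * 1)) * 1)
    b = pred (1 * suc d * 2)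

    x≃a/b : toℚᵘ x ℚᵘ.≃ mkℚᵘ (ℤ.+ a) b
    x≃a/b = ℚᵘ.≃-trans (ℚ.toℚᵘ-homo-* (1ℚ ℚ.+ ε) ½)
      (ℚᵘ.*-congʳ (ℚ.toℚᵘ-homo-+ 1ℚ ε))

    a≥ : 2 + d ≤ a
    a≥ = s≤s (begin
      suc d                                  ≤⟨ s≤s (m≤m+n d p) ⟩
      suc (d + p)                            ≡⟨ rearrange d p ⟩
      (d + 0 * suc d + suc (p * 1)) * 1      ∎)
      where
      open ≤-Reasoning
      rearrange : ∀ d p → suc (d + p) ≡ (d + 0 * suc d + suc (p * 1)) * 1
      rearrange = solve-∀

  -- It is enough to have 1/(d + 1) ≤ ε in place of ε: the hypothesis is 2c ≤ (1 + 1/(d + 1)) √t,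
  -- squared and without denominators.
  ≤·√-intro : ∀ c t → (suc d * (2 * c)) * (suc d * (2 * c)) ≤ (2 + d) * (2 + d) * t →
              c ≤ (1ℚ ℚ.+ ε) ℚ.* ½ ·√ t
  ≤·√-intro c t le = ℚ.toℚᵘ-cancel-≤ (begin
    toℚᵘ (cℚ ℚ.* cℚ)
      ≃⟨ ℚᵘ.≃-trans (ℚ.toℚᵘ-homo-* cℚ cℚ) (ℚᵘ.*-cong ≃c ≃c) ⟩
    mkℚᵘ (ℤ.+ c) 0 ℚᵘ.* mkℚᵘ (ℤ.+ c) 0
      ≤⟨ square≤ a b c t (≤-trans (≤-trans (≤-reflexive (rearrange d c)) le)
           (*-monoˡ-≤ t (*-mono-≤ a≥ a≥))) ⟩
    mkℚᵘ (ℤ.+ a) b ℚᵘ.* mkℚᵘ (ℤ.+ a) b ℚᵘ.* mkℚᵘ (ℤ.+ t) 0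
      ≃⟨ ℚᵘ.≃-trans (ℚ.toℚᵘ-homo-* (x ℚ.* x) tℚ)
           (ℚᵘ.*-cong (ℚᵘ.≃-trans (ℚ.toℚᵘ-homo-* x x) (ℚᵘ.*-cong x≃a/b x≃a/b)) ≃t) ⟨
    toℚᵘ (x ℚ.* x ℚ.* tℚ) ∎)
    where
    open ℚᵘ.≤-Reasoning
    cℚ = ℤ.+ c ℚ./ 1
    tℚ = ℤ.+ t ℚ./ 1
    ≃c : toℚᵘ cℚ ℚᵘ.≃ mkℚᵘ (ℤ.+ c) 0
    ≃c = ℚ.toℚᵘ-fromℚᵘ (mkℚᵘ (ℤ.+ c) 0)
    ≃t : toℚᵘ tℚ ℚᵘ.≃ mkℚᵘ (ℤ.+ t) 0
    ≃t = ℚ.toℚᵘ-fromℚᵘ (mkℚᵘ (ℤ.+ t) 0)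
    rearrange : ∀ d c → (1 * suc d * 2) * (1 * suc d * 2) * (c * c)
                      ≡ (suc d * (2 * c)) * (suc d * (2 * c))
    rearrange = solve-∀

-- The extremal number and its asymptotic bound.

2*ex≤ : ∀ l k n s → k * n < suc s * suc s →
        2 * ex n (path (suc (suc l))) (cycle (2 * suc k)) ≤
        n * (s + suc (suc k + 2 * suc (k + k))) ^ suc l
2*ex≤ l k n s q<s⁺² = argmax-all id {P = λ c → 2 * c ≤ bound} z≤n
  (map⁺ (All.map (λ {G} → few {G}) (all-filter cycle-free? (allGraphs n))))
  where
  C = suc k + 2 * suc (k + k)
  bound = n * (s + suc C) ^ suc l
  cycle-free? = λ G → count (cycle (2 * suc k)) G ≟ℕ 0
  q≤ : k * n ≤ (C + suc s) * suc s
  q≤ = ≤-trans (<⇒≤ q<s⁺²) (*-monoˡ-≤ (suc s) (m≤n+m (suc s) C))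
  C+s⁺≡ : C + suc s ≡ s + suc C
  C+s⁺≡ = trans (+-suc C s) (trans (cong suc (+-comm C s)) (sym (+-suc s C)))
  few : ∀ {G} → count (cycle (2 * suc k)) G ≡ 0 → 2 * count (path (suc (suc l))) G ≤ bound
  few {G} free = begin
    2 * count (path (suc (suc l))) G          ≤⟨ 2*count-path≤walks l G ⟩
    ∑ (allFin n) (walks# G (suc l))
      ≤⟨ walks≤ G (k * n) C (∑-deg-nbrs≤ G k free) (suc s) q≤ (suc l) ⟩
    n * (C + suc s) ^ suc l             ≡⟨ cong (λ m → n * m ^ suc l) C+s⁺≡ ⟩
    n * (s + suc C) ^ suc l             ∎
    where open ≤-Reasoning

square-bound : ∀ l k d n s c →
  suc d * (2 * c) ≤ (2 + d) * (n * s ^ suc l) → s * s ≤ k * n →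
  (suc d * (2 * c)) * (suc d * (2 * c)) ≤ (2 + d) * (2 + d) * (k ^ suc l * n ^ (2 + l + 1))
square-bound l k d n s c root s²≤q = begin
  (suc d * (2 * c)) * (suc d * (2 * c))
    ≤⟨ *-mono-≤ root root ⟩
  ((2 + d) * (n * s ^ j)) * ((2 + d) * (n * s ^ j))
    ≡⟨ rearrange₁ (2 + d) n (s ^ j) ⟩
  (2 + d) * (2 + d) * (s ^ j * s ^ j * (n * n))
    ≡⟨ cong (λ t → (2 + d) * (2 + d) * (t * (n * n))) (^-distribʳ-* s s j) ⟨
  (2 + d) * (2 + d) * ((s * s) ^ j * (n * n))
    ≤⟨ *-monoʳ-≤ ((2 + d) * (2 + d)) (*-monoˡ-≤ (n * n) (^-monoˡ-≤ j s²≤q)) ⟩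
  (2 + d) * (2 + d) * ((k * n) ^ j * (n * n))
    ≡⟨ cong (λ t → (2 + d) * (2 + d) * (t * (n * n))) (^-distribʳ-* k n j) ⟩
  (2 + d) * (2 + d) * (k ^ j * n ^ j * (n * n))
    ≡⟨ rearrange₂ ((2 + d) * (2 + d)) (k ^ j) (n ^ j) n ⟩
  (2 + d) * (2 + d) * (k ^ j * n ^ (2 + j))
    ≡⟨ cong (λ i → (2 + d) * (2 + d) * (k ^ j * n ^ (2 + i))) (+-comm 1 l) ⟩
  (2 + d) * (2 + d) * (k ^ j * n ^ (2 + l + 1)) ∎
  where
  open ≤-Reasoning
  j = suc l
  rearrange₁ : ∀ a b c → (a * (b * c)) * (a * (b * c)) ≡ a * a * (c * c * (b * b))
  rearrange₁ = solve-∀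
  rearrange₂ : ∀ a b c n → a * (b * c * (n * n)) ≡ a * (b * (n * (n * c)))
  rearrange₂ = solve-∀

asymptotic-bound : ∀ l k .{{_ : NonZero k}} D p d .{co : Coprime (suc p) (suc d)} →
  ∃[ N ] (∀ n c → N ≤ n →
    (∀ s → k * n < suc s * suc s → 2 * c ≤ n * (s + D) ^ suc l) →
    c ≤ (1ℚ ℚ.+ mkℚ (ℤ.+ suc p) d co) ℚ.* ½ ·√ (k ^ suc l * n ^ (2 + l + 1)))
asymptotic-bound l k D p d {co} = S * S , λ n c S²≤n 2c≤ →
  let s , s²≤q , q<s⁺² = √-floor (k * n) in
  ≤·√-intro p d {co} c (k ^ suc l * n ^ (2 + l + 1))
    (square-bound l k d n s c (root n c s S²≤n q<s⁺² (2c≤ s q<s⁺²)) s²≤q)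
  where
  open ≤-Reasoning
  S = proj₁ (shifted-power-asymptotic (suc d) D (suc l))
  asymp = proj₂ (shifted-power-asymptotic (suc d) D (suc l))
  rearrange : ∀ a b c → a * (b * c) ≡ b * (a * c)
  rearrange = solve-∀
  root : ∀ n c s → S * S ≤ n → k * n < suc s * suc s → 2 * c ≤ n * (s + D) ^ suc l →
         suc d * (2 * c) ≤ (2 + d) * (n * s ^ suc l)
  root n c s S²≤n q<s⁺² 2c≤ = begin
    suc d * (2 * c)                  ≤⟨ *-monoʳ-≤ (suc d) 2c≤ ⟩
    suc d * (n * (s + D) ^ suc l)    ≡⟨ rearrange (suc d) n ((s + D) ^ suc l) ⟩
    n * (suc d * (s + D) ^ suc l)    ≤⟨ *-monoʳ-≤ n (asymp s S≤s) ⟩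
    n * ((2 + d) * s ^ suc l)        ≡⟨ rearrange n (2 + d) (s ^ suc l) ⟩
    (2 + d) * (n * s ^ suc l)        ∎
    where
    S≤s : S ≤ s
    S≤s = ≮⇒≥ λ s<S → <⇒≱ q<s⁺² (≤-trans (*-mono-≤ s<S s<S) (≤-trans S²≤n (m≤n*m n k)))

theorem17 : (l k : ℕ) → 2 ≤ l → 2 ≤ k →
    (ε : ℚ) → 0ℚ ℚ.< ε →
    ∃[ N ] ((n : ℕ) → N ≤ n →
    ex n (path l) (cycle (2 * k))
    ≤ (1ℚ ℚ.+ ε) ℚ.* ½ ·√ ((k ∸ 1) ^ (l ∸ 1) * n ^ (l + 1)))
theorem17 _ _ _ _ (mkℚ (ℤ.+ zero) _ _) (ℚ.*<* (ℤ.+<+ ()))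
theorem17 (suc (suc l)) (suc k@(suc _)) (s≤s (s≤s _)) (s≤s (s≤s _)) (mkℚ (ℤ.+ suc p) d co) _ =
  let N , large = asymptotic-bound l k (suc (suc k + 2 * suc (k + k))) p d {co} in
  N , λ n N≤n → large n (ex n (path (suc (suc l))) (cycle (2 * suc k))) N≤n (2*ex≤ l k n)
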